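{- For every $\Gamma\cup\{\phi\}\subseteq\mathcal{L}_{\Box\Diamond}$: $\Gamma\Vdash^{\mathrm{inm}}\phi$ if and only if $\Gamma\models\phi$.
   Context: $\mathcal{L}_{\Box\Diamond}$: formulas $\phi ::= p_i \mid \bot \mid \phi\wedge\phi \mid \phi\vee\phi \mid \phi\to\phi \mid \Box\phi \mid \Diamond\phi$ over a countable set of proposition letters $p_i$. Intuitionistic neighbourhood models: for a poset $(W,\le)$, an intuitionistic neighbourhood is a partial function $a:W\rightharpoonup\mathcal{P}(W)$ whose domain $\mathrm{dom}(a)$ is an upset. A model is $\mathcal{M}=(W,\le,N,V)$ with $N$ a set of intuitionistic neighbourhoods and $V$ mapping proposition letters to upsets; $N_w=\{a\in N\mid w\in\mathrm{dom}(a)\}$. Truth: $w\Vdash p$ iff $w\in V(p)$; $\bot$ never; $\wedge,\vee$ pointwise; $w\Vdash\phi\to\psi$ iff for all $v\ge w$, $v\Vdash\phi$ implies $v\Vdash\psi$; $w\Vdash\Box\phi$ iff there is $a\in N_w$ such that for all $w'\ge w$ and all $v\in a(w')$, $v\Vdash\phi$; $w\Vdash\Diamond\phi$ iff for all $w'\ge w$ and all $a\in N_{w'}$ there is $v\in a(w')$ with $v\Vdash\phi$. $\Gamma\Vdash^{\mathrm{inm}}\phi$: in every such model, every world satisfying all of $\Gamma$ satisfies $\phi$. $\mathsf{IFOM}$-structures: $\mathfrak{M}=(W,\le,\mathcal{I})$ with $(W,\le)$ a poset and, for each $w$, sets $\mathcal{I}(\mathsf{s},w),\mathcal{I}(\mathsf{n},w)$,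 relations $\mathcal{I}(\mathsf{N},w)\subseteq\mathcal{I}(\mathsf{s},w)\times\mathcal{I}(\mathsf{n},w)$, $\mathcal{I}(\mathsf{E},w)\subseteq\mathcal{I}(\mathsf{n},w)\times\mathcal{I}(\mathsf{s},w)$, $\mathcal{I}(P_i,w)\subseteq\mathcal{I}(\mathsf{s},w)$, all increasing along $\le$. Evaluation at $(w,x)$ with $x\in\mathcal{I}(\mathsf{s},w)$: $w,x\models p_i$ iff $x\in\mathcal{I}(P_i,w)$; $\bot$ never; $\wedge,\vee$ pointwise; $w,x\models\phi\to\psi$ iff for all $w'\ge w$, $w',x\models\phi$ implies $w',x\models\psi$; $w,x\models\Box\phi$ iff there is $a\in\mathcal{I}(\mathsf{n},w)$ with $(x,a)\in\mathcal{I}(\mathsf{N},w)$ such that for all $w'\ge w$, $x'\in\mathcal{I}(\mathsf{s},w')$ with $(a,x')\in\mathcal{I}(\mathsf{E},w')$, $w',x'\models\phi$; $w,x\models\Diamond\phi$ iff for all $w'\ge w$ and $a'\in\mathcal{I}(\mathsf{n},w')$ with $(x,a')\in\mathcal{I}(\mathsf{N},w')$ there is $y'\in\mathcal{I}(\mathsf{s},w')$ with $(a',y')\in\mathcal{I}(\mathsf{E},w')$ and $w',y'\models\phi$. $\Gamma\models\phi$: for all $\mathsf{IFOM}$-structures and pairs $(w,x)$, satisfying all of $\Gamma$ implies satisfying $\phi$. -}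

module Defs where

open import Level using (Level; suc; _⊔_)
open import Data.Nat using (ℕ)
open import Data.Empty.Polymorphic using (⊥)
open import Data.Product using (Σ; _×_; ∃)
open import Data.Sum using (_⊎_)
open import Relation.Binary.PropositionalEquality using (_≡_)

data Form : Set where
  var  : ℕ → Form
  ⊥'   : Form
  _∧'_ : Form → Form → Form
  _∨'_ : Form → Form → Form
  _⇒_  : Form → Form → Form
  □    : Form → Form
  ◇    : Form → Form

FormSet : Set₁
FormSet = Form → Set

record INM (ℓ : Level) : Set (suc ℓ) where
  field
    W       : Set ℓ
    _≤_     : W → W → Set ℓ
    ≤-refl  : ∀ {w} → w ≤ w
    ≤-trans : ∀ {u v w} → u ≤ v → v ≤ w → u ≤ w
    ≤-antisym : ∀ {u v} → u ≤ v → v ≤ u → u ≡ v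
    -- the set N of intuitionistic neighbourhoods, indexed by Nb
    Nb      : Set ℓ
    dom     : Nb → W → Set ℓ
    dom-up  : ∀ {a w w'} → w ≤ w' → dom a w → dom a w'
    -- a(w) ⊆ W (only consulted for w ∈ dom(a); the partial function a is
    -- represented by an arbitrary total extension)
    app     : Nb → W → W → Set ℓ
    V       : ℕ → W → Set ℓ
    V-up    : ∀ {i w w'} → w ≤ w' → V i w → V i w'

module _ {ℓ : Level} (M : INM ℓ) where
  open INM M

  _⊩_ : W → Form → Set ℓ
  w ⊩ var i   = V i w
  w ⊩ ⊥'      = ⊥
  w ⊩ (φ ∧' ψ) = (w ⊩ φ) × (w ⊩ ψ)
  w ⊩ (φ ∨' ψ) = (w ⊩ φ) ⊎ (w ⊩ ψ)
  w ⊩ (φ ⇒ ψ) = ∀ v → w ≤ v → v ⊩ φ → v ⊩ ψ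
  w ⊩ □ φ     = Σ Nb λ a → dom a w ×
                  (∀ w' → w ≤ w' → ∀ v → app a w' v → v ⊩ φ)
  w ⊩ ◇ φ     = ∀ w' → w ≤ w' → ∀ a → dom a w' →
                  Σ W λ v → app a w' v × (v ⊩ φ)

_⊩inm[_]_ : FormSet → (ℓ : Level) → Form → Set (suc ℓ)
Γ ⊩inm[ ℓ ] φ = (M : INM ℓ) → ∀ w →
  (∀ ψ → Γ ψ → _⊩_ M w ψ) → _⊩_ M w φ

-- IFOM-structures (universe level ℓ).
-- Varying domains are represented as increasing predicates over fixed
-- carrier types Ds (sort s) and Dn (sort n).

record IFOM (ℓ : Level) : Set (suc ℓ) where
  field
    W       : Set ℓ
    _≤_     : W → W → Set ℓ
    ≤-refl  : ∀ {w} → w ≤ w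
    ≤-trans : ∀ {u v w} → u ≤ v → v ≤ w → u ≤ w
    ≤-antisym : ∀ {u v} → u ≤ v → v ≤ u → u ≡ v
    Ds      : Set ℓ
    Dn      : Set ℓ
    Is      : W → Ds → Set ℓ
    In      : W → Dn → Set ℓ
    IN      : W → Ds → Dn → Set ℓ
    IE      : W → Dn → Ds → Set ℓ
    IP      : ℕ → W → Ds → Set ℓ
    IN-sort : ∀ {w x a} → IN w x a → Is w x × In w a
    IE-sort : ∀ {w a x} → IE w a x → In w a × Is w x
    IP-sort : ∀ {i w x} → IP i w x → Is w x
    Is-up   : ∀ {w w' x} → w ≤ w' → Is w x → Is w' x
    In-up   : ∀ {w w' a} → w ≤ w' → In w a → In w' a
    IN-up   : ∀ {w w' x a} → w ≤ w' → IN w x a → IN w' x a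
    IE-up   : ∀ {w w' a x} → w ≤ w' → IE w a x → IE w' a x
    IP-up   : ∀ {i w w' x} → w ≤ w' → IP i w x → IP i w' x

module _ {ℓ : Level} (𝔐 : IFOM ℓ) where
  open IFOM 𝔐

  -- w , x ⊨ φ  (meaningful for x ∈ I(s,w))
  _,_⊨_ : W → Ds → Form → Set ℓ
  w , x ⊨ var i    = IP i w x
  w , x ⊨ ⊥'       = ⊥
  w , x ⊨ (φ ∧' ψ) = (w , x ⊨ φ) × (w , x ⊨ ψ)
  w , x ⊨ (φ ∨' ψ) = (w , x ⊨ φ) ⊎ (w , x ⊨ ψ)
  w , x ⊨ (φ ⇒ ψ)  = ∀ w' → w ≤ w' → w' , x ⊨ φ → w' , x ⊨ ψ
  w , x ⊨ □ φ      = Σ Dn λ a → In w a × IN w x a ×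
                       (∀ w' → w ≤ w' → ∀ x' → Is w' x' → IE w' a x' →
                          w' , x' ⊨ φ)
  w , x ⊨ ◇ φ      = ∀ w' → w ≤ w' → ∀ a' → In w' a' → IN w' x a' →
                       Σ Ds λ y' → Is w' y' × IE w' a' y' × (w' , y' ⊨ φ)

_⊨[_]_ : FormSet → (ℓ : Level) → Form → Set (suc ℓ)
Γ ⊨[ ℓ ] φ = (𝔐 : IFOM ℓ) → ∀ w x → IFOM.Is 𝔐 w x →
  (∀ ψ → Γ ψ → _,_⊨_ 𝔐 w x ψ) → _,_⊨_ 𝔐 w x φ

{-# OPTIONS --safe #-}
module Submission where

-- An IFOM-structure becomes a neighbourhood model whose worlds are the pairs (w , x).
--
-- For the converse, the worlds of the IFOM-structure are finite histories of moves of elements to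
-- larger positions, ordered by extension.  Moving one element and leaving the others in place needs
-- decidable equality of elements, which the worlds of the given model M may lack.  Hence only
-- the copies of one distinguished element are placed in M; all others are placed at types, i.e. finite sets of
-- subformulas of some F, obtained by elimination: a type S is discarded once every world of M
-- forcing S is known to force a further subformula of F.  Since a discarded type comes with such a
-- proof, every world of M can be completed to a surviving type by adding formulas one at a time,
-- without deciding whether the world forces them.
--
-- The extensions of the neighbourhoods of an IFOM-structure only grow.  So a neighbourhood refuting
-- ◇φ is created by the very move that needs it; it contains everything later on, which keeps it
-- from forcing new boxes.

open import Defs
open import Level using (Level; Lift; lift; lower) renaming (suc to lsuc)
open import Data.Empty.Polymorphic using (⊥; ⊥-elim)
open import Data.List using (List; []; _∷_; _++_; length; map; filter)
import Data.List.Membership.DecPropositional as DecMembership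
import Data.List.Relation.Binary.Subset.DecPropositional as DecSubset
open import Data.List.Membership.Propositional using (_∈_; _∉_)
open import Data.List.Membership.Propositional.Properties
  using (∈-++⁺ˡ; ∈-++⁺ʳ; ∈-++⁻; ∈-map⁺; ∈-map⁻; ∈-filter⁺; ∈-filter⁻)
open import Data.List.Properties using (filter-notAll; ≡-dec)
open import Data.List.Relation.Binary.Subset.Propositional using (_⊆_)
open import Data.List.Relation.Binary.Subset.Propositional.Properties using (∈-∷⁺ʳ)
open import Data.List.Relation.Unary.Any as Any using (here; there)
open import Data.Maybe using (Maybe; just; nothing)
import Data.Maybe.Properties as Maybe
open import Data.Nat using (ℕ; suc; _≤_; s≤s) renaming (_⊔_ to _⊔ℕ_; _≟_ to _≟ℕ_)
open import Data.Nat.Properties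
  using (≤-refl; ≤-trans; m≤n⇒m≤1+n; <-irrefl; <-≤-trans; m≤m⊔n; m≤n⊔m)
open import Data.Product using (Σ; ∃; _×_; _,_; proj₁; proj₂)
import Data.Product.Properties as Product
open import Data.Sum using (_⊎_; inj₁; inj₂; swap) renaming (map to map-⊎)
open import Data.Unit.Polymorphic using (⊤; tt)
open import Function using (_∘_; id)
open import Relation.Binary using (DecidableEquality)
open import Relation.Binary.PropositionalEquality using (_≡_; _≢_; refl; sym; cong; cong₂; subst)
open import Relation.Nullary using (Dec; yes; no; ¬_; ¬?; contradiction)
open import Relation.Nullary.Decidable using (map′; _×-dec_; toSum)

-- From IFOM-structures to neighbourhood models.

module _ {ℓ : Level} (𝔐 : IFOM ℓ) where
  open IFOM 𝔐
    renaming (_≤_ to _≤ʷ_; ≤-refl to ≤ʷ-refl; ≤-trans to ≤ʷ-trans; ≤-antisym to ≤ʷ-antisym)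

  -- A neighbourhood at `(w , x)` stays at `w`: the clause for `□` ranges over larger worlds anyway,
  -- and the one for `◇` wants its witness at the world where the neighbourhood is taken.
  pairModel : INM ℓ
  pairModel = record
    { W         = W × Ds
    ; _≤_       = λ (w , x) (w' , x') → w ≤ʷ w' × x ≡ x'
    ; ≤-refl    = ≤ʷ-refl , refl
    ; ≤-trans   = λ { (p , refl) (q , refl) → ≤ʷ-trans p q , refl }
    ; ≤-antisym = λ { (p , refl) (q , _) → cong (_, _) (≤ʷ-antisym p q) }
    ; Nb        = Dn
    ; dom       = λ a (w , x) → IN w x a
    ; dom-up    = λ { (p , refl) → IN-up p }
    ; app       = λ a (w , _) (w' , x') → w ≡ w' × IE w a x'
    ; V         = λ i (w , x) → IP i w x
    ; V-up      = λ { (p , refl) → IP-up p }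
    }

  -- The sort conditions on `IN` and `IE` supply the memberships that the modal clauses ask for.
  pairModel-truth : ∀ φ {w x} →
    (_⊩_ pairModel (w , x) φ → _,_⊨_ 𝔐 w x φ) × (_,_⊨_ 𝔐 w x φ → _⊩_ pairModel (w , x) φ)
  pairModel-truth (var i)  = id , id
  pairModel-truth ⊥'       = id , id
  pairModel-truth (φ ∧' ψ) =
      (λ (p , q) → pairModel-truth φ .proj₁ p , pairModel-truth ψ .proj₁ q)
    , (λ (p , q) → pairModel-truth φ .proj₂ p , pairModel-truth ψ .proj₂ q)
  pairModel-truth (φ ∨' ψ) =
      map-⊎ (pairModel-truth φ .proj₁) (pairModel-truth ψ .proj₁)
    , map-⊎ (pairModel-truth φ .proj₂) (pairModel-truth ψ .proj₂)
  pairModel-truth (φ ⇒ ψ)  =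
      (λ f w' p h → pairModel-truth ψ .proj₁ (f (w' , _) (p , refl) (pairModel-truth φ .proj₂ h)))
    , (λ { f (w' , _) (p , refl) h → pairModel-truth ψ .proj₂ (f w' p (pairModel-truth φ .proj₁ h)) })
  pairModel-truth (□ φ)    =
      (λ (a , d , f) → a , proj₂ (IN-sort d) , d ,
        λ w' p x' _ e → pairModel-truth φ .proj₁ (f (w' , _) (p , refl) (w' , x') (refl , e)))
    , (λ (a , _ , d , f) → a , d ,
        λ { (w' , _) (p , refl) (_ , x') (refl , e) →
              pairModel-truth φ .proj₂ (f w' p x' (proj₂ (IE-sort e)) e) })
  pairModel-truth (◇ φ)    =
      (λ f w' p a _ d → case-◇ (f (w' , _) (p , refl) a d))
    , (λ { f (w' , _) (p , refl) a d →
             let (y , _ , e , h) = f w' p a (proj₂ (IN-sort d)) d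
             in (w' , y) , (refl , e) , pairModel-truth φ .proj₂ h })
    where
    case-◇ : ∀ {w' a} →
      Σ (W × Ds) (λ v → (w' ≡ proj₁ v × IE w' a (proj₂ v)) × _⊩_ pairModel v φ) →
      Σ Ds (λ y → Is w' y × IE w' a y × _,_⊨_ 𝔐 w' y φ)
    case-◇ ((_ , y) , (refl , e) , h) = y , proj₂ (IE-sort e) , e , pairModel-truth φ .proj₁ h

-- Decidable equality of formulas.

tag : Form → ℕ
tag (var _)  = 0
tag ⊥'       = 1
tag (_ ∧' _) = 2
tag (_ ∨' _) = 3
tag (_ ⇒ _)  = 4
tag (□ _)    = 5
tag (◇ _)    = 6

mutual
  _≟ᶠ_ : DecidableEquality Form
  φ ≟ᶠ ψ with tag φ ≟ℕ tag ψ
  ... | yes e = sameTag φ ψ e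
  ... | no  n = no (n ∘ cong tag)

  -- Comparing tags first leaves only the diagonal cases to treat.
  sameTag : ∀ φ ψ → tag φ ≡ tag ψ → Dec (φ ≡ ψ)
  sameTag (var i)  (var j)    _ = map′ (cong var) (λ { refl → refl }) (i ≟ℕ j)
  sameTag ⊥'       ⊥'         _ = yes refl
  sameTag (φ ∧' ψ) (φ' ∧' ψ') _ = 
    map′ (λ (p , q) → cong₂ _∧'_ p q) (λ { refl → refl , refl }) (φ ≟ᶠ φ' ×-dec ψ ≟ᶠ ψ')
  sameTag (φ ∨' ψ) (φ' ∨' ψ') _ = 
    map′ (λ (p , q) → cong₂ _∨'_ p q) (λ { refl → refl , refl }) (φ ≟ᶠ φ' ×-dec ψ ≟ᶠ ψ')
  sameTag (φ ⇒ ψ)  (φ' ⇒ ψ')  _ = 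
    map′ (λ (p , q) → cong₂ _⇒_ p q) (λ { refl → refl , refl }) (φ ≟ᶠ φ' ×-dec ψ ≟ᶠ ψ')
  sameTag (□ φ)    (□ φ')     _ = map′ (cong □) (λ { refl → refl }) (φ ≟ᶠ φ')
  sameTag (◇ φ)    (◇ φ')     _ = map′ (cong ◇) (λ { refl → refl }) (φ ≟ᶠ φ')

-- The interface between positions and structures.

⊤' : Form
⊤' = ⊥' ⇒ ⊥'

parts : Form → List Form
parts (var i)  = []
parts ⊥'       = []
parts (φ ∧' ψ) = φ ∷ ψ ∷ []
parts (φ ∨' ψ) = φ ∷ ψ ∷ []
parts (φ ⇒ ψ)  = φ ∷ ψ ∷ []
parts (□ φ)    = φ ∷ []
parts (◇ φ)    = φ ∷ []

-- An abstract recipe for an IFOM-structure. Every element occupies a position, which moves upwards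
-- as worlds grow; elements start at the position of their seed.  Scope limits the formulas about
-- which a position makes a claim.  A cut at a position is a neighbourhood which, at the moment of
-- its creation, has only elements at Allowed positions.
record Blueprint (ℓ : Level) : Set (lsuc ℓ) where
  field
    Pos      : Set ℓ
    _⊑_      : Pos → Pos → Set ℓ
    ⊑-refl   : ∀ {p} → p ⊑ p
    ⊑-trans  : ∀ {p q r} → p ⊑ q → q ⊑ r → p ⊑ r
    Scope    : Pos → Form → Set ℓ
    Scope-up : ∀ {p q φ} → p ⊑ q → Scope p φ → Scope q φ
    Scope-part : ∀ {p φ χ} → Scope p φ → χ ∈ parts φ → Scope p χ
    Holds    : Pos → Form → Set ℓ
    Holds-up : ∀ {p q φ} → p ⊑ q → Holds p φ → Holds q φ
    Seed     : Set ℓ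
    _≟ˢ_     : DecidableEquality Seed
    init     : Seed → Pos
    Cut      : Pos → Set ℓ
    Allowed  : ∀ {p} → Cut p → Pos → Set ℓ
    holds-⊥  : ∀ {p} → Scope p ⊥' → Holds p ⊥' → ⊥ {ℓ}
    holds-∧  : ∀ {p φ ψ} → Scope p (φ ∧' ψ) →
               (Holds p φ × Holds p ψ → Holds p (φ ∧' ψ)) × (Holds p (φ ∧' ψ) → Holds p φ × Holds p ψ)
    holds-∨  : ∀ {p φ ψ} → Scope p (φ ∨' ψ) →
               (Holds p φ ⊎ Holds p ψ → Holds p (φ ∨' ψ)) × (Holds p (φ ∨' ψ) → Holds p φ ⊎ Holds p ψ)
    holds-⇒  : ∀ {p φ ψ} → Scope p (φ ⇒ ψ) →
               ((∀ q → p ⊑ q → Holds q φ → Holds q ψ) → Holds p (φ ⇒ ψ)) ×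
               (Holds p (φ ⇒ ψ) → Holds p φ → Holds p ψ)
    -- Testing seeds suffices, because every history leaves some copy of each seed unmoved.
    holds-□  : ∀ {p φ ψ} → Scope p (□ ψ) → Holds p (□ φ) →
               (∀ s → Scope (init s) φ → Holds (init s) φ → Scope (init s) ψ → Holds (init s) ψ) →
               Holds p (□ ψ)
    holds-□◇ : ∀ {p φ ψ} → Scope p (◇ ψ) → Holds p (□ φ) → Holds p (◇ ψ) →
               Σ Seed λ s → Scope (init s) φ × Holds (init s) φ × Scope (init s) ψ × Holds (init s) ψ
    -- `□ ⊤'` says that there is a neighbourhood at all. Every box that a cut makes true is traced
    -- back to it, as a cut later contains every element.
    cut-□    : ∀ {p} → Cut p → Holds p (□ ⊤')
    cut-◇    : ∀ {p φ} (κ : Cut p) → Scope p (◇ φ) → Holds p (◇ φ) →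
               Σ Seed λ s → Allowed κ (init s) × Scope (init s) φ × Holds (init s) φ
    -- Classically: if `◇ φ` fails, some cut above allows only positions that have `φ` in scope and
    -- fail it.
    holds-◇  : ∀ {p φ} → Scope p (◇ φ) →
               (∀ q → p ⊑ q → (κ : Cut q) → Σ Pos λ r → Allowed κ r × (Scope r φ → Holds r φ)) →
               Holds p (◇ φ)

-- The structure of histories and its truth lemma.

module Structure {ℓ : Level} (B : Blueprint ℓ) where
  open Blueprint B

  -- A seed has infinitely many copies, so that after finitely many moves some copy is still in place.
  Elem : Set ℓ
  Elem = Seed × ℕ

  _≟ᵉ_ : DecidableEquality Elem
  _≟ᵉ_ = Product.≡-dec _≟ˢ_ _≟ℕ_

  record Move : Set ℓ where
    constructor move
    field
      elem   : Elem
      target : Pos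
      cut    : Maybe (Cut target)
  open Move

  -- Most recent move first.
  History : Set ℓ
  History = List Move

  place : History → Elem → Pos
  place []      x = init (proj₁ x)
  place (m ∷ h) x with x ≟ᵉ elem m
  ... | yes _ = target m
  ... | no  _ = place h x

  -- Only the moves added to `h` must go upwards; `h` itself is an arbitrary list.
  data _≼_ (h : History) : History → Set ℓ where
    stop : h ≼ h
    step : ∀ {m h'} → h ≼ h' → place h' (elem m) ⊑ target m → h ≼ (m ∷ h')

  ≼-trans : ∀ {f g h} → f ≼ g → g ≼ h → f ≼ h
  ≼-trans p stop       = p
  ≼-trans p (step q v) = step (≼-trans p q) v

  ≼-length : ∀ {g h} → g ≼ h → length g ≤ length h
  ≼-length stop       = ≤-refl
  ≼-length (step p _) = m≤n⇒m≤1+n (≼-length p)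

  ≼-irrefl : ∀ {g h m} → g ≼ h → g ≢ m ∷ h
  ≼-irrefl p refl = <-irrefl refl (≼-length p)

  -- Proper extensions are longer, so this holds although `_⊑_` is only a preorder.
  ≼-antisym : ∀ {g h} → g ≼ h → h ≼ g → g ≡ h
  ≼-antisym stop       _ = refl
  ≼-antisym (step p _) q = contradiction (<-≤-trans (s≤s (≼-length p)) (≼-length q)) (<-irrefl refl)

  place-step : ∀ {m} h x → place h (elem m) ⊑ target m → place h x ⊑ place (m ∷ h) x
  place-step {m} h x v with x ≟ᵉ elem m
  ... | yes refl = v
  ... | no  _    = ⊑-refl

  place-up : ∀ {g h} x → g ≼ h → place g x ⊑ place h x
  place-up x stop       = ⊑-refl
  place-up x (step p v) = ⊑-trans (place-up x p) (place-step _ x v)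

  place-moved : ∀ x p {c} h → place (move x p c ∷ h) x ≡ p
  place-moved x p h with x ≟ᵉ x
  ... | yes _ = refl
  ... | no ¬q = contradiction refl ¬q

  -- Exceeds the number of every copy moved in the history, so the copy with this number is still in
  -- place for every seed.
  bound : History → ℕ
  bound []      = 0
  bound (m ∷ h) = suc (proj₂ (elem m)) ⊔ℕ bound h

  place-unmoved : ∀ h s {n} → bound h ≤ n → place h (s , n) ≡ init s
  place-unmoved []      s _ = refl
  place-unmoved (m ∷ h) s {n} b with (s , n) ≟ᵉ elem m
  ... | yes refl = contradiction (≤-trans (m≤m⊔n (suc n) (bound h)) b) (<-irrefl refl)
  ... | no  _    = place-unmoved h s (≤-trans (m≤n⊔m (suc (proj₂ (elem m))) (bound h)) b)

  fresh : ∀ h s → Σ Elem λ y → place h y ≡ init s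
  fresh h s = (s , bound h) , place-unmoved h s ≤-refl

  data CutAt (x : Elem) : History → Set ℓ where
    cutAt : ∀ {p κ h} → CutAt x (move x p (just κ) ∷ h)

  -- `⊤` is a default for histories not ending with a cut; by `CutAt`, these are neighbourhoods of
  -- no element.
  AllowedAt : History → Pos → Set ℓ
  AllowedAt []                       _ = ⊤
  AllowedAt (move _ _ nothing  ∷ _)  _ = ⊤
  AllowedAt (move _ _ (just κ) ∷ _)  q = Allowed κ q

  -- A formula φ names the neighbourhood of all elements satisfying φ.  A history ending with a cut
  -- names a neighbourhood that respects the cut at this history and contains everything later.
  structure : IFOM ℓ
  structure = record
    { W = History ; _≤_ = _≼_ ; ≤-refl = stop ; ≤-trans = ≼-trans ; ≤-antisym = ≼-antisym
    ; Ds = Elem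
    ; Dn = Form ⊎ History
    ; Is = λ _ _ → ⊤
    ; In = λ _ _ → ⊤
    ; IN = Nbh
    ; IE = Ext
    ; IP = λ i h x → Holds (place h x) (var i)
    ; IN-sort = λ _ → tt , tt
    ; IE-sort = λ _ → tt , tt
    ; IP-sort = λ _ → tt
    ; Is-up = λ _ _ → tt
    ; In-up = λ _ _ → tt
    ; IN-up = λ {_} {_} {x} {a} → Nbh-up x a
    ; IE-up = λ {_} {_} {a} {x} → Ext-up a x
    ; IP-up = λ {_} {_} {_} {x} p → Holds-up (place-up x p)
    }
    where
    Nbh : History → Elem → Form ⊎ History → Set ℓ
    Nbh h x (inj₁ φ) = Holds (place h x) (□ φ)
    Nbh h x (inj₂ g) = g ≼ h × CutAt x g

    Ext : History → Form ⊎ History → Elem → Set ℓ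
    Ext h (inj₁ φ) y = Scope (place h y) φ × Holds (place h y) φ
    Ext h (inj₂ g) y = g ≼ h × (g ≡ h → AllowedAt g (place h y))

    Nbh-up : ∀ {g h} x a → g ≼ h → Nbh g x a → Nbh h x a
    Nbh-up x (inj₁ _) p q       = Holds-up (place-up x p) q
    Nbh-up x (inj₂ _) p (q , c) = ≼-trans q p , c

    Ext-up : ∀ {g h} a y → g ≼ h → Ext g a y → Ext h a y
    Ext-up (inj₁ _) y p (s , q) = Scope-up (place-up y p) s , Holds-up (place-up y p) q
    -- If the larger history is `f` itself, antisymmetry squeezes the middle one onto `f`.
    Ext-up (inj₂ f) y p (q , c) = ≼-trans q p , λ where
      refl → subst (λ k → AllowedAt f (place k y)) (≼-antisym p q) (c (≼-antisym q p))

  _,_⊨ˢ_ : History → Elem → Form → Set ℓ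
  h , x ⊨ˢ φ = _,_⊨_ structure h x φ

  mutual
    -- Both directions of the truth lemma go by one induction, since antecedents of implications
    -- exchange them.
    sound : ∀ φ h x → Scope (place h x) φ → h , x ⊨ˢ φ → Holds (place h x) φ
    sound (var i)  h x s t = t
    sound (φ ∧' ψ) h x s (t , u) = holds-∧ s .proj₁
      (sound φ h x (Scope-part s (here refl)) t , sound ψ h x (Scope-part s (there (here refl))) u)
    sound (φ ∨' ψ) h x s t = holds-∨ s .proj₁
      (map-⊎ (sound φ h x (Scope-part s (here refl))) (sound ψ h x (Scope-part s (there (here refl)))) t)
    sound (φ ⇒ ψ)  h x s t = holds-⇒ s .proj₁ λ q p⊑q hq →
      -- Moving `x` alone turns the larger position `q` into a larger world.
      let h' = move x q nothing ∷ h
          eq = place-moved x q h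
          s' = Scope-up (subst (place h x ⊑_) (sym eq) p⊑q) s
      in subst (λ r → Holds r ψ) eq
           (sound ψ h' x (Scope-part s' (there (here refl)))
             (t h' (step stop p⊑q)
               (complete φ h' x (Scope-part s' (here refl)) (subst (λ r → Holds r φ) (sym eq) hq))))
    sound (□ ψ)    h x s (inj₁ φ , _ , b , t) = holds-□ s b λ σ sφ hφ sψ →
      -- An unmoved copy of `σ` transfers the truth of `ψ` in the structure to `init σ`.
      let (y , eq) = fresh h σ
      in subst (λ r → Holds r ψ) eq
           (sound ψ h y (subst (λ r → Scope r ψ) (sym eq) sψ)
             (t h stop y tt
               (subst (λ r → Scope r φ) (sym eq) sφ , subst (λ r → Holds r φ) (sym eq) hφ)))
    sound (□ ψ)    h x s (inj₂ g , _ , (g≼h , c) , t) = holds-□ s (cutAt-□ c g≼h) λ σ _ _ sψ →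
      -- Any further move, even a trivial one, puts all elements into the neighbourhood g.
      let h'       = move x (place h x) nothing ∷ h
          h≼h'     = step stop ⊑-refl
          (y , eq) = fresh h' σ
      in subst (λ r → Holds r ψ) eq
           (sound ψ h' y (subst (λ r → Scope r ψ) (sym eq) sψ)
             (t h' h≼h' y tt (≼-trans g≼h h≼h' , λ e → contradiction e (≼-irrefl g≼h))))
    sound (◇ φ)    h x s t = holds-◇ s λ q p⊑q κ →
      -- The cut is created by this very move, so the witness `y` that the diamond yields at `h'` is
      -- still at an allowed position.
      let h' = move x q (just κ) ∷ h
          (y , _ , (_ , e) , u) = t h' (step stop p⊑q) (inj₂ h') tt (stop , cutAt)
      in place h' y , e refl , λ sφ → sound φ h' y sφ u

    complete : ∀ φ h x → Scope (place h x) φ → Holds (place h x) φ → h , x ⊨ˢ φ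
    complete (var i)  h x s t = t
    complete ⊥'       h x s t = holds-⊥ s t
    complete (φ ∧' ψ) h x s t =
      let (u , v) = holds-∧ s .proj₂ t
      in complete φ h x (Scope-part s (here refl)) u , complete ψ h x (Scope-part s (there (here refl))) v
    complete (φ ∨' ψ) h x s t =
      map-⊎ (complete φ h x (Scope-part s (here refl))) (complete ψ h x (Scope-part s (there (here refl))))
        (holds-∨ s .proj₂ t)
    complete (φ ⇒ ψ)  h x s t h' p u =
      let s' = Scope-up (place-up x p) s
      in complete ψ h' x (Scope-part s' (there (here refl)))
           (holds-⇒ s' .proj₂ (Holds-up (place-up x p) t) (sound φ h' x (Scope-part s' (here refl)) u))
    complete (□ φ)    h x s t = inj₁ φ , tt , t , λ h' _ y _ (sφ , hφ) → complete φ h' y sφ hφ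
    complete (◇ φ)    h x s t h' p a _ b =
      complete-◇ φ h' x (Scope-up (place-up x p) s) (Holds-up (place-up x p) t) a b

    complete-◇ : ∀ φ h x → Scope (place h x) (◇ φ) → Holds (place h x) (◇ φ) →
      ∀ a → IFOM.IN structure h x a → Σ Elem λ y → ⊤ {ℓ} × IFOM.IE structure h a y × h , y ⊨ˢ φ
    complete-◇ φ h x s t (inj₁ ψ) b =
      let (σ , sψ , hψ , sφ , hφ) = holds-□◇ s b t
          (y , eq) = fresh h σ
      in y , tt , (subst (λ r → Scope r ψ) (sym eq) sψ , subst (λ r → Holds r ψ) (sym eq) hψ)
           , complete φ h y (subst (λ r → Scope r φ) (sym eq) sφ) (subst (λ r → Holds r φ) (sym eq) hφ)
    complete-◇ φ _ x s t (inj₂ (move .x p (just κ) ∷ g)) (stop , cutAt) =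
      let h = move x p (just κ) ∷ g
          eqx = place-moved x p g
          (σ , al , sφ , hφ) = cut-◇ κ (subst (λ r → Scope r (◇ φ)) eqx s)
                                     (subst (λ r → Holds r (◇ φ)) eqx t)
          (y , eq) = fresh h σ
      in y , tt , (stop , λ _ → subst (Allowed κ) (sym eq) al)
           , complete φ h y (subst (λ r → Scope r φ) (sym eq) sφ) (subst (λ r → Holds r φ) (sym eq) hφ)
    -- Past its creation the cut no longer restricts its members, so any seed holding `φ` will do;
    -- `□ ⊤'` provides one.
    complete-◇ φ h x s t (inj₂ g) (step g≼k v , c) =
      let (σ , _ , _ , sφ , hφ) = holds-□◇ s (cutAt-□ c (step g≼k v)) t
          (y , eq) = fresh h σ
      in y , tt , (step g≼k v , λ e → contradiction e (≼-irrefl g≼k))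
           , complete φ h y (subst (λ r → Scope r φ) (sym eq) sφ) (subst (λ r → Holds r φ) (sym eq) hφ)

    cutAt-□ : ∀ {g h x} → CutAt x g → g ≼ h → Holds (place h x) (□ ⊤')
    cutAt-□ {x = x} (cutAt {p} {κ} {k}) g≼h =
      Holds-up (place-up x g≼h) (subst (λ r → Holds r (□ ⊤')) (sym (place-moved x p k)) (cut-□ κ))

-- Subformulas, finite search, and the demands on types.

sub : Form → List Form
sub φ@(var _)  = φ ∷ []
sub φ@⊥'       = φ ∷ []
sub φ@(α ∧' β) = φ ∷ sub α ++ sub β
sub φ@(α ∨' β) = φ ∷ sub α ++ sub β
sub φ@(α ⇒ β)  = φ ∷ sub α ++ sub β
sub φ@(□ α)    = φ ∷ sub α
sub φ@(◇ α)    = φ ∷ sub α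

sub-refl : ∀ φ → φ ∈ sub φ
sub-refl (var _)  = here refl
sub-refl ⊥'       = here refl
sub-refl (_ ∧' _) = here refl
sub-refl (_ ∨' _) = here refl
sub-refl (_ ⇒ _)  = here refl
sub-refl (□ _)    = here refl
sub-refl (◇ _)    = here refl

sub-parts : ∀ φ {ψ χ} → ψ ∈ sub φ → χ ∈ parts ψ → χ ∈ sub φ
sub-parts₂ : ∀ α β {ψ χ} → ψ ∈ sub α ++ sub β → χ ∈ parts ψ → χ ∈ sub α ++ sub β
sub-here₂ : ∀ α β {χ} → χ ∈ α ∷ β ∷ [] → χ ∈ sub α ++ sub β

sub-parts (var _)  (here refl) ()
sub-parts ⊥'       (here refl) ()
sub-parts (α ∧' β) (here refl) c = there (sub-here₂ α β c)
sub-parts (α ∧' β) (there p)   c = there (sub-parts₂ α β p c)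
sub-parts (α ∨' β) (here refl) c = there (sub-here₂ α β c)
sub-parts (α ∨' β) (there p)   c = there (sub-parts₂ α β p c)
sub-parts (α ⇒ β)  (here refl) c = there (sub-here₂ α β c)
sub-parts (α ⇒ β)  (there p)   c = there (sub-parts₂ α β p c)
sub-parts (□ α)    (here refl) (here refl) = there (sub-refl α)
sub-parts (□ α)    (there p)   c = there (sub-parts α p c)
sub-parts (◇ α)    (here refl) (here refl) = there (sub-refl α)
sub-parts (◇ α)    (there p)   c = there (sub-parts α p c)

sub-parts₂ α β p c with ∈-++⁻ (sub α) p
... | inj₁ q = ∈-++⁺ˡ (sub-parts α q c)
... | inj₂ q = ∈-++⁺ʳ (sub α) (sub-parts β q c)

sub-here₂ α β (here refl)         = ∈-++⁺ˡ (sub-refl α)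
sub-here₂ α β (there (here refl)) = ∈-++⁺ʳ (sub α) (sub-refl β)

-- Both alternatives carry evidence, so neither property has to be decidable. This matters for
-- `Refuted`, which speaks about all worlds.
search : ∀ {a p q} {A : Set a} {P : A → Set p} {Q : A → Set q} xs →
  (∀ {x} → x ∈ xs → P x ⊎ Q x) →
  (Σ A λ x → x ∈ xs × P x) ⊎ (∀ {x} → x ∈ xs → Q x)
search []       f = inj₂ λ ()
search (x ∷ xs) f with f (here refl) | search xs (f ∘ there)
... | inj₁ p | _                = inj₁ (x , here refl , p)
... | inj₂ q | inj₁ (y , m , p) = inj₁ (y , there m , p)
... | inj₂ q | inj₂ g           = inj₂ λ { (here refl) → q ; (there m) → g m }

sublists : ∀ {a} {A : Set a} → List A → List (List A)
sublists []       = [] ∷ []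
sublists (x ∷ xs) = map (x ∷_) (sublists xs) ++ sublists xs

sublists-⊆ : ∀ {a} {A : Set a} (xs : List A) {ys} → ys ∈ sublists xs → ys ⊆ xs
sublists-⊆ []       (here refl) ()
sublists-⊆ (x ∷ xs) m k with ∈-++⁻ (map (x ∷_) (sublists xs)) m
... | inj₂ m' = there (sublists-⊆ xs m' k)
... | inj₁ m' with ∈-map⁻ (x ∷_) m'
sublists-⊆ (x ∷ xs) m (here e)  | inj₁ m' | _ , m'' , refl = here e
sublists-⊆ (x ∷ xs) m (there k) | inj₁ m' | _ , m'' , refl = there (sublists-⊆ xs m'' k)

-- Filtering picks a canonical list for each decidable subset.
filter-∈-sublists : ∀ {a p} {A : Set a} {P : A → Set p} (P? : ∀ x → Dec (P x)) xs →
  filter P? xs ∈ sublists xs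
filter-∈-sublists P? []       = here refl
filter-∈-sublists P? (x ∷ xs) with P? x
... | yes _ = ∈-++⁺ˡ (∈-map⁺ (x ∷_) (filter-∈-sublists P? xs))
... | no  _ = ∈-++⁺ʳ (map (x ∷_) (sublists xs)) (filter-∈-sublists P? xs)

-- A missing implication, box or diamond demands witnesses in `𝒯`. For a missing `◇ β` these are a
-- larger type `S'` and, for each `◇ α` in `S'`, a type with `α` but without `β`: together they form
-- a neighbourhood that avoids `β` and meets every diamond of `S'`.
Clause : List (List Form) → List Form → Form → Set
Clause 𝒯 S (var _)  = ⊤
Clause 𝒯 S ⊥'       = ⊥' ∉ S
Clause 𝒯 S (α ∧' β) = (α ∈ S × β ∈ S → α ∧' β ∈ S) × (α ∧' β ∈ S → α ∈ S × β ∈ S)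
Clause 𝒯 S (α ∨' β) = (α ∈ S ⊎ β ∈ S → α ∨' β ∈ S) × (α ∨' β ∈ S → α ∈ S ⊎ β ∈ S)
Clause 𝒯 S (α ⇒ β)  = (α ⇒ β ∈ S ⊎ ∃ λ S' → S' ∈ 𝒯 × S ⊆ S' × α ∈ S' × β ∉ S')
                    × (α ⇒ β ∈ S → α ∈ S → β ∈ S)
Clause 𝒯 S (□ β)    = □ β ∈ S ⊎ (∀ {α} → □ α ∈ S → ∃ λ S' → S' ∈ 𝒯 × α ∈ S' × β ∉ S')
Clause 𝒯 S (◇ β)    = (◇ β ∈ S ⊎ ∃ λ S' → S' ∈ 𝒯 × S ⊆ S' × □ ⊤' ∈ S' ×
                         (∀ {α} → ◇ α ∈ S' → ∃ λ S″ → S″ ∈ 𝒯 × α ∈ S″ × β ∉ S″))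
                    × (◇ β ∈ S → ∀ {α} → □ α ∈ S → ∃ λ S' → S' ∈ 𝒯 × α ∈ S' × β ∈ S')

Coherent : Form → List (List Form) → Set
Coherent F 𝒯 = ∀ {S} → S ∈ 𝒯 → S ⊆ sub F × (∀ χ → χ ∈ sub F → Clause 𝒯 S χ)

-- Elimination of types over a neighbourhood model.

open DecMembership _≟ᶠ_ using (_∈?_)
open DecSubset _≟ᶠ_ using (_⊆?_)

module Elimination {ℓ : Level} (M : INM ℓ) where
  open INM M renaming (_≤_ to _≤ʷ_; ≤-refl to ≤ʷ-refl; ≤-trans to ≤ʷ-trans)

  infix 4 _⊩ᴹ_ _⊩*_
  _⊩ᴹ_ : W → Form → Set ℓ
  v ⊩ᴹ φ = _⊩_ M v φ

  persistent : ∀ φ {v v'} → v ≤ʷ v' → v ⊩ᴹ φ → v' ⊩ᴹ φ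
  persistent (var i)  p t           = V-up p t
  persistent (φ ∧' ψ) p (t , u)     = persistent φ p t , persistent ψ p u
  persistent (φ ∨' ψ) p t           = map-⊎ (persistent φ p) (persistent ψ p) t
  persistent (φ ⇒ ψ)  p t w q       = t w (≤ʷ-trans p q)
  persistent (□ φ)    p (a , d , t) = a , dom-up p d , λ w q → t w (≤ʷ-trans p q)
  persistent (◇ φ)    p t w q       = t w (≤ʷ-trans p q)

  _⊩*_ : W → List Form → Set ℓ
  v ⊩* Δ = ∀ {χ} → χ ∈ Δ → v ⊩ᴹ χ

  persistent* : ∀ {Δ v v'} → v ≤ʷ v' → v ⊩* Δ → v' ⊩* Δ
  persistent* p t {χ} m = persistent χ p (t m)

  ⊩*-∷ : ∀ {Δ v χ} → v ⊩ᴹ χ → v ⊩* Δ → v ⊩* (χ ∷ Δ)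
  ⊩*-∷ t h (here refl) = t
  ⊩*-∷ t h (there m)   = h m

  ⊩⊤' : ∀ {v} → v ⊩ᴹ ⊤'
  ⊩⊤' _ _ b = b

  module _ (F : Form) (□⊤∈F : □ ⊤' ∈ sub F) where

    Refuted : List Form → Set ℓ
    Refuted S = ∀ {v} → v ⊩* S → ∃ λ χ → χ ∈ sub F × χ ∉ S × v ⊩ᴹ χ

    -- The world may force more subformulas than the type found for it.
    Realising : List (List Form) → Set ℓ
    Realising 𝒯 = ∀ {v} Δ → Δ ⊆ sub F → v ⊩* Δ → ∃ λ S → S ∈ 𝒯 × Δ ⊆ S × v ⊩* S

    extends? : ∀ 𝒯 α β →
      (∃ λ S → S ∈ 𝒯 × α ∈ S × β ∉ S) ⊎ (∀ {S} → S ∈ 𝒯 → α ∈ S → β ∈ S)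
    extends? 𝒯 α β = search 𝒯 λ {S} _ → split S (α ∈? S) (β ∈? S)
      where
      split : ∀ S → Dec (α ∈ S) → Dec (β ∈ S) → (α ∈ S × β ∉ S) ⊎ (α ∈ S → β ∈ S)
      split S _       (yes b) = inj₂ λ _ → b
      split S (yes a) (no b)  = inj₁ (a , b)
      split S (no a)  (no _)  = inj₂ λ a' → contradiction a' a

    -- If `𝒯` lacks a demanded witness, completing worlds of `M` to types in `𝒯` shows that every
    -- world forcing `S` forces the missing formula.
    clause : ∀ {𝒯 S} → (∀ {S'} → S' ∈ 𝒯 → S' ⊆ sub F) → Realising 𝒯 → S ⊆ sub F →
             ∀ χ → χ ∈ sub F → Clause 𝒯 S χ ⊎ Refuted S
    clause 𝒯⊆ real S⊆ (var _) _ = inj₁ tt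
    clause {S = S} 𝒯⊆ real S⊆ ⊥' _ with ⊥' ∈? S
    ... | yes m = inj₂ λ h → ⊥-elim (h m)
    ... | no  m = inj₁ m
    clause {S = S} 𝒯⊆ real S⊆ (α ∧' β) χ∈ with α ∧' β ∈? S | α ∈? S | β ∈? S
    ... | yes m | yes a | yes b = inj₁ ((λ _ → m) , λ _ → a , b)
    ... | yes m | no a  | _     = inj₂ λ h → α , sub-parts F χ∈ (here refl) , a , proj₁ (h m)
    ... | yes m | _     | no b  = inj₂ λ h → β , sub-parts F χ∈ (there (here refl)) , b , proj₂ (h m)
    ... | no m  | yes a | yes b = inj₂ λ h → α ∧' β , χ∈ , m , h a , h b
    ... | no m  | no a  | _     = inj₁ ((λ (a' , _) → contradiction a' a) , λ m' → contradiction m' m)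
    ... | no m  | _     | no b  = inj₁ ((λ (_ , b') → contradiction b' b) , λ m' → contradiction m' m)
    clause {S = S} 𝒯⊆ real S⊆ (α ∨' β) χ∈ with α ∨' β ∈? S | α ∈? S | β ∈? S
    ... | yes m | yes a | _     = inj₁ ((λ _ → m) , λ _ → inj₁ a)
    ... | yes m | _     | yes b = inj₁ ((λ _ → m) , λ _ → inj₂ b)
    ... | no m  | yes a | _     = inj₂ λ h → α ∨' β , χ∈ , m , inj₁ (h a)
    ... | no m  | _     | yes b = inj₂ λ h → α ∨' β , χ∈ , m , inj₂ (h b)
    ... | no m  | no a  | no b  = inj₁ ((λ { (inj₁ a') → contradiction a' a
                                           ; (inj₂ b') → contradiction b' b })
                                       , λ m' → contradiction m' m)
    ... | yes m | no a  | no b  = inj₂ λ h → refute (h m)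
      where
      refute : ∀ {v} → v ⊩ᴹ α ⊎ v ⊩ᴹ β → ∃ λ χ → χ ∈ sub F × χ ∉ S × v ⊩ᴹ χ
      refute (inj₁ t) = α , sub-parts F χ∈ (here refl) , a , t
      refute (inj₂ t) = β , sub-parts F χ∈ (there (here refl)) , b , t
    clause {𝒯} {S} 𝒯⊆ real S⊆ (α ⇒ β) χ∈ with α ⇒ β ∈? S
    ... | yes m = modusPonens (α ∈? S) (β ∈? S)
      where
      modusPonens : Dec (α ∈ S) → Dec (β ∈ S) → Clause 𝒯 S (α ⇒ β) ⊎ Refuted S
      modusPonens _       (yes b) = inj₁ (inj₁ m , λ _ _ → b)
      modusPonens (no a)  _       = inj₁ (inj₁ m , λ _ a' → contradiction a' a)
      modusPonens (yes a) (no b)  =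
        inj₂ λ {v} h → β , sub-parts F χ∈ (there (here refl)) , b , h m v ≤ʷ-refl (h a)
    ... | no m with search 𝒯 (λ {S'} _ → split S' (S ⊆? S') (α ∈? S') (β ∈? S'))
      where
      split : ∀ S' → Dec (S ⊆ S') → Dec (α ∈ S') → Dec (β ∈ S') →
        (S ⊆ S' × α ∈ S' × β ∉ S') ⊎ (S ⊆ S' → α ∈ S' → β ∈ S')
      split S' _       _       (yes b) = inj₂ λ _ _ → b
      split S' (no s)  _       _       = inj₂ λ s' → contradiction (λ {x} → s' {x}) s
      split S' _       (no a)  _       = inj₂ λ _ a' → contradiction a' a
      split S' (yes s) (yes a) (no b)  = inj₁ (s , a , b)
    ... | inj₁ w = inj₁ (inj₂ w , λ m' → contradiction m' m)
    -- A larger world forcing `α` completes to a type containing `S` and `α`, which by the failed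
    -- search contains `β`.
    ... | inj₂ f = inj₂ λ h → α ⇒ β , χ∈ , m , λ v p t →
            let (S' , S'∈ , s , hS') = real (α ∷ S) (∈-∷⁺ʳ (sub-parts F χ∈ (here refl)) S⊆)
                                         (⊩*-∷ t (persistent* p h))
            in hS' (f S'∈ (s ∘ there) (s (here refl)))
    clause {𝒯} {S} 𝒯⊆ real S⊆ (□ β) χ∈ with □ β ∈? S
    ... | yes m = inj₁ (inj₁ m)
    ... | no  m with search (sub F) (λ {α} _ → swap (split α (□ α ∈? S)))
      where
      split : ∀ α → Dec (□ α ∈ S) →
        (□ α ∈ S → ∃ λ S' → S' ∈ 𝒯 × α ∈ S' × β ∉ S') ⊎
        (□ α ∈ S × (∀ {S'} → S' ∈ 𝒯 → α ∈ S' → β ∈ S'))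
      split α (no n)  = inj₁ λ n' → contradiction n' n
      split α (yes n) with extends? 𝒯 α β
      ... | inj₁ e = inj₁ λ _ → e
      ... | inj₂ f = inj₂ (n , f)
    ... | inj₂ g = inj₁ (inj₂ λ n → g (sub-parts F (S⊆ n) (here refl)) n)
    -- All types with `α` contain `β`, so the neighbourhood witnessing `□ α` also witnesses `□ β`.
    ... | inj₁ (α , α∈ , n , f) = inj₂ λ h →
            let (a , d , t) = h n
            in □ β , χ∈ , m , a , d , λ w p v e →
                 let (S' , S'∈ , s , hS') = real (α ∷ []) (∈-∷⁺ʳ α∈ λ ()) (⊩*-∷ (t w p v e) λ ())
                 in hS' (f S'∈ (s (here refl)))
    clause {𝒯} {S} 𝒯⊆ real S⊆ (◇ β) χ∈ with ◇ β ∈? S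
    ... | yes m with search (sub F) (λ {α} _ → swap (split α (□ α ∈? S)))
      where
      split : ∀ α → Dec (□ α ∈ S) →
        (□ α ∈ S → ∃ λ S' → S' ∈ 𝒯 × α ∈ S' × β ∈ S') ⊎
        (□ α ∈ S × (∀ {S'} → S' ∈ 𝒯 → ¬ (α ∈ S' × β ∈ S')))
      split α (no n)  = inj₁ λ n' → contradiction n' n
      split α (yes n) with search 𝒯 (λ {S'} _ → toSum ((α ∈? S') ×-dec (β ∈? S')))
      ... | inj₁ e = inj₁ λ _ → e
      ... | inj₂ f = inj₂ (n , f)
    ... | inj₂ g = inj₁ (inj₁ m , λ _ n → g (sub-parts F (S⊆ n) (here refl)) n)
    -- No type contains both `α` and `β`, yet a world forcing `S` would have a neighbour forcing
    -- both. So no world forces `S`.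
    ... | inj₁ (α , α∈ , n , f) = inj₂ λ {v} h →
            let (a , d , t) = h n
                (v' , e , u) = h m v ≤ʷ-refl a d
                (S' , S'∈ , s , _) = real (α ∷ β ∷ []) 
                                       (∈-∷⁺ʳ α∈ (∈-∷⁺ʳ (sub-parts F χ∈ (here refl)) λ ()))
                                       (⊩*-∷ (t v ≤ʷ-refl v' e) (⊩*-∷ u λ ()))
            in contradiction (s (here refl) , s (there (here refl))) (f S'∈)
    clause {𝒯} {S} 𝒯⊆ real S⊆ (◇ β) χ∈ | no m with search 𝒯 (λ {S'} _ → split S' (S ⊆? S') (□ ⊤' ∈? S'))
      where
      split : ∀ S' → Dec (S ⊆ S') → Dec (□ ⊤' ∈ S') →
        (S ⊆ S' × □ ⊤' ∈ S' × (∀ {α} → α ∈ sub F → ◇ α ∈ S' → ∃ λ S″ → S″ ∈ 𝒯 × α ∈ S″ × β ∉ S″)) ⊎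
        (S ⊆ S' → □ ⊤' ∈ S' → ∃ λ α → α ∈ sub F × ◇ α ∈ S' × (∀ {S″} → S″ ∈ 𝒯 → α ∈ S″ → β ∈ S″))
      split S' (no s)  _       = inj₂ λ s' → contradiction (λ {x} → s' {x}) s
      split S' _       (no n)  = inj₂ λ _ n' → contradiction n' n
      split S' (yes s) (yes n) with search (sub F) (λ {α} _ → inner α (◇ α ∈? S'))
        where
        inner : ∀ α → Dec (◇ α ∈ S') →
          (◇ α ∈ S' × (∀ {S″} → S″ ∈ 𝒯 → α ∈ S″ → β ∈ S″)) ⊎
          (◇ α ∈ S' → ∃ λ S″ → S″ ∈ 𝒯 × α ∈ S″ × β ∉ S″)
        inner α (no k)  = inj₂ λ k' → contradiction k' k
        inner α (yes k) with extends? 𝒯 α β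
        ... | inj₁ e = inj₂ λ _ → e
        ... | inj₂ f = inj₁ (k , f)
      ... | inj₁ w = inj₂ λ _ _ → w
      ... | inj₂ g = inj₁ (s , n , g)
    ... | inj₁ (S' , S'∈ , s , n , g) =
            inj₁ ( inj₂ (S' , S'∈ , s , n , λ k → g (sub-parts F (𝒯⊆ S'∈ k) (here refl)) k)
                 , λ m' → contradiction m' m)
    -- The neighbourhood `a` makes `v` force `□ ⊤'`, so the completed type meets the conditions of
    -- the failed search. The resulting `◇ α` finds a member of `a` forcing `α`, hence `β`.
    ... | inj₂ f = inj₂ λ h → ◇ β , χ∈ , m , λ v p a d →
            let (S' , S'∈ , s , hS') = real (□ ⊤' ∷ S) (∈-∷⁺ʳ □⊤∈F S⊆)
                                         (⊩*-∷ (a , d , λ _ _ _ _ → ⊩⊤') (persistent* p h))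
                (α , α∈ , k , g) = f S'∈ (s ∘ there) (s (here refl))
                (v' , e , t) = hS' k v ≤ʷ-refl a d
                (S″ , S″∈ , s' , hS″) = real (α ∷ []) (∈-∷⁺ʳ α∈ λ ()) (⊩*-∷ t λ ())
            in v' , e , hS″ (g S″∈ (s' (here refl)))

    -- The invariant of the elimination: whatever was discarded has been refuted.
    Exhaustive : List (List Form) → Set ℓ
    Exhaustive 𝒯 = ∀ {S} → S ∈ sublists (sub F) → S ∈ 𝒯 ⊎ Refuted S

    -- While the canonical list for `Δ` is not in `𝒯`, its refutation yields a further forced
    -- subformula to add. `R` covers the subformulas still missing, and its length bounds the
    -- additions.
    exhaustive⇒realising : ∀ {𝒯} → Exhaustive 𝒯 → Realising 𝒯
    exhaustive⇒realising {𝒯} exh Δ Δ⊆ h = grow _ Δ (sub F) ≤-refl (λ m → inj₂ m) Δ⊆ h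
      where
      grow : ∀ n {v} Δ R → length R ≤ n → (∀ {χ} → χ ∈ sub F → χ ∈ Δ ⊎ χ ∈ R) →
             Δ ⊆ sub F → v ⊩* Δ → ∃ λ S → S ∈ 𝒯 × Δ ⊆ S × v ⊩* S
      grow n {v} Δ R len cover Δ⊆ h with exh (filter-∈-sublists (_∈? Δ) (sub F))
      ... | inj₁ S∈ = _ , S∈ , (λ m → ∈-filter⁺ (_∈? Δ) (Δ⊆ m) m)
                         , λ m → h (proj₂ (∈-filter⁻ (_∈? Δ) {xs = sub F} m))
      ... | inj₂ refuted with refuted (λ m → h (proj₂ (∈-filter⁻ (_∈? Δ) {xs = sub F} m)))
      ...   | χ , χ∈ , χ∉ , t with cover χ∈
      ...     | inj₁ m = contradiction (∈-filter⁺ (_∈? Δ) χ∈ m) χ∉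
      ...     | inj₂ m = smaller n len
        where
        ≢χ? : ∀ ξ → Dec (ξ ≢ χ)
        ≢χ? ξ = ¬? (ξ ≟ᶠ χ)

        cover' : ∀ {ξ} → ξ ∈ sub F → ξ ∈ χ ∷ Δ ⊎ ξ ∈ filter ≢χ? R
        cover' {ξ} ξ∈ with ξ ≟ᶠ χ | cover ξ∈
        ... | yes e | _      = inj₁ (here e)
        ... | no _  | inj₁ k = inj₁ (there k)
        ... | no ne | inj₂ k = inj₂ (∈-filter⁺ ≢χ? k ne)

        smaller : ∀ n → length R ≤ n → ∃ λ S → S ∈ 𝒯 × Δ ⊆ S × v ⊩* S
        smaller n len with ≤-trans (filter-notAll ≢χ? R (Any.map (λ { refl ne → ne refl }) m)) len
        smaller (suc n) len | s≤s len' =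
          let (S , S∈ , s , hS) = grow n (χ ∷ Δ) (filter ≢χ? R) len' cover' (∈-∷⁺ʳ χ∈ Δ⊆) (⊩*-∷ t h)
          in S , S∈ , s ∘ there , hS

    -- Refutations mention `M` but not `𝒯`, so they survive later removals; the clauses are checked
    -- afresh each time. `n` bounds the number of removals.
    eliminate : ∀ n 𝒯 → length 𝒯 ≤ n → (∀ {S} → S ∈ 𝒯 → S ⊆ sub F) → Exhaustive 𝒯 →
                ∃ λ 𝒯' → Coherent F 𝒯' × Realising 𝒯'
    eliminate n 𝒯 len 𝒯⊆ exh with search 𝒯 (λ S∈ → swap (clauses S∈))
      where
      clauses : ∀ {S} → S ∈ 𝒯 → (∀ χ → χ ∈ sub F → Clause 𝒯 S χ) ⊎ Refuted S
      clauses S∈ with search (sub F) (λ {χ} χ∈ →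
                        swap (clause 𝒯⊆ (exhaustive⇒realising exh) (𝒯⊆ S∈) χ χ∈))
      ... | inj₁ (_ , _ , r) = inj₂ r
      ... | inj₂ c           = inj₁ λ _ → c
    ... | inj₂ c = 𝒯 , (λ S∈ → 𝒯⊆ S∈ , c S∈) , exhaustive⇒realising exh
    ... | inj₁ (S , S∈ , r) = smaller n len
      where
      ≢S? : ∀ S' → Dec (S' ≢ S)
      ≢S? S' = ¬? (≡-dec _≟ᶠ_ S' S)

      exh' : Exhaustive (filter ≢S? 𝒯)
      exh' {S'} m with ≡-dec _≟ᶠ_ S' S | exh m
      ... | yes refl | _       = inj₂ r
      ... | no _     | inj₂ r' = inj₂ r'
      ... | no ne    | inj₁ k  = inj₁ (∈-filter⁺ ≢S? k ne)

      smaller : ∀ n → length 𝒯 ≤ n → ∃ λ 𝒯' → Coherent F 𝒯' × Realising 𝒯'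
      smaller n len with ≤-trans (filter-notAll ≢S? 𝒯 (Any.map (λ { refl ne → ne refl }) S∈)) len
      smaller (suc n) len | s≤s len' =
        eliminate n (filter ≢S? 𝒯) len' (λ m → 𝒯⊆ (proj₁ (∈-filter⁻ ≢S? m))) exh'

    coherentRealising : ∃ λ 𝒯 → Coherent F 𝒯 × Realising 𝒯
    coherentRealising = eliminate _ (sublists (sub F)) ≤-refl (sublists-⊆ (sub F)) inj₁

-- Worlds and tableaux as positions.

module Positions {ℓ : Level} (M : INM ℓ) (w₀ : INM.W M) where
  open INM M using (W; Nb; dom; app)
    renaming (_≤_ to _≤ʷ_; ≤-refl to ≤ʷ-refl; ≤-trans to ≤ʷ-trans)
  open Elimination M

  -- Bare data without a proof of `Good`, so that seeds have decidable equality; `Scope` brings the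
  -- proof back.
  record Tableau : Set ℓ where
    constructor tableau
    field
      root  : Form
      types : List (List Form)
      type  : List Form
  open Tableau

  Good : Tableau → Set
  Good t = Coherent (root t) (types t) × type t ∈ types t

  _≟ᵗ_ : DecidableEquality Tableau
  tableau F 𝒯 S ≟ᵗ tableau F' 𝒯' S' =
    map′ (λ { (refl , refl , refl) → refl }) (λ { refl → refl , refl , refl })
      (F ≟ᶠ F' ×-dec ≡-dec (≡-dec _≟ᶠ_) 𝒯 𝒯' ×-dec ≡-dec _≟ᶠ_ S S')

  Position : Set ℓ
  Position = W ⊎ Tableau

  -- The implication in `table` keeps good tableaux good on the way up.
  data _⊑_ : Position → Position → Set ℓ where
    world : ∀ {u v} → u ≤ʷ v → inj₁ u ⊑ inj₁ v
    table : ∀ {F 𝒯 S S'} → S ⊆ S' → (S ∈ 𝒯 → S' ∈ 𝒯) → inj₂ (tableau F 𝒯 S) ⊑ inj₂ (tableau F 𝒯 S')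

  Scope : Position → Form → Set ℓ
  Scope (inj₁ _) φ = ⊤
  Scope (inj₂ t) φ = Lift ℓ (Good t × φ ∈ sub (root t))

  Holds : Position → Form → Set ℓ
  Holds (inj₁ u) φ = u ⊩ᴹ φ
  Holds (inj₂ t) φ = Lift ℓ (φ ∈ type t)

  Holds-up : ∀ {p q} φ → p ⊑ q → Holds p φ → Holds q φ
  Holds-up φ (world p)   h        = persistent φ p h
  Holds-up φ (table s _) (lift m) = lift (s m)

  init : Maybe Tableau → Position
  init nothing  = inj₁ w₀
  init (just t) = inj₂ t

  -- A world cuts down one of its neighbourhoods a to the types realised by members of a that
  -- have an opinion on φ; a type cuts down to the types refuting φ.
  Cut : Position → Set ℓ
  Cut (inj₁ u) = (Σ Nb λ a → dom a u) × Form
  Cut (inj₂ t) = Lift ℓ (Σ Form λ φ → φ ∈ sub (root t) × □ ⊤' ∈ type t ×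
                   (∀ {χ} → ◇ χ ∈ type t → ∃ λ S → S ∈ types t × χ ∈ S × φ ∉ S))

  Allowed : ∀ {p} → Cut p → Position → Set ℓ
  Allowed          _                (inj₁ _) = ⊥
  Allowed {inj₁ u} ((a , _) , φ)    q@(inj₂ t) = Scope q φ × Σ W λ v → app a u v × v ⊩* type t
  Allowed {inj₂ _} (lift (φ , _))   q@(inj₂ t) = Scope q φ × φ ∉ type t

  -- The conjunction `F` is chosen to have `φ`, `ψ` and the `□ ⊤'` required by the elimination among
  -- its subformulas.
  realise : ∀ φ ψ {v} Δ → Δ ⊆ φ ∷ ψ ∷ [] → v ⊩* Δ →
    ∃ λ t → Scope (inj₂ t) φ × Scope (inj₂ t) ψ × Δ ⊆ type t × v ⊩* type t
  realise φ ψ Δ Δ⊆ h =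
    let F = □ ⊤' ∧' (φ ∧' ψ)
        F∈ = sub-refl F
        both∈ = sub-parts F F∈ (there (here refl))
        φ∈ = sub-parts F both∈ (here refl)
        ψ∈ = sub-parts F both∈ (there (here refl))
        (𝒯 , coh , real) = coherentRealising F (sub-parts F F∈ (here refl))
        (S , S∈ , s , hS) = real Δ (λ m → pair φ∈ ψ∈ (Δ⊆ m)) h
    in tableau F 𝒯 S , lift ((coh , S∈) , φ∈) , lift ((coh , S∈) , ψ∈) , s , hS
    where
    pair : ∀ {Φ} → φ ∈ Φ → ψ ∈ Φ → φ ∷ ψ ∷ [] ⊆ Φ
    pair p q (here refl)         = p
    pair p q (there (here refl)) = q

  ⊩*-[] : ∀ {v} → v ⊩* []
  ⊩*-[] ()

  [φ]⊆ : ∀ {φ ψ : Form} → φ ∷ [] ⊆ φ ∷ ψ ∷ []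
  [φ]⊆ (here e) = here e

  ruleOf : ∀ {t} χ → Scope (inj₂ t) χ → Clause (types t) (type t) χ
  ruleOf χ (lift ((coh , S∈) , χ∈)) = proj₂ (coh S∈) χ χ∈

  sibling : ∀ {t S φ} → Good t → S ∈ types t → φ ∈ S → Scope (inj₂ (tableau (root t) (types t) S)) φ
  sibling (coh , _) S∈ m = lift ((coh , S∈) , proj₁ (coh S∈) m)

  blueprint : Blueprint ℓ
  blueprint = record
    { Pos = Position
    ; _⊑_ = _⊑_
    ; ⊑-refl = λ { {inj₁ _} → world ≤ʷ-refl ; {inj₂ _} → table id id }
    ; ⊑-trans = λ { (world p) (world q) → world (≤ʷ-trans p q)
                  ; (table s f) (table s' f') → table (s' ∘ s) (f' ∘ f) }
    ; Scope = Scope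
    ; Scope-up = λ { (world _) _ → tt
                   ; (table _ f) (lift ((coh , S∈) , m)) → lift ((coh , f S∈) , m) }
    ; Scope-part = λ { {inj₁ _} _ _ → tt
                     ; {inj₂ t} (lift (g , m)) c → lift (g , sub-parts (root t) m c) }
    ; Holds = Holds
    ; Holds-up = λ {_} {_} {φ} → Holds-up φ
    ; Seed = Maybe Tableau
    ; _≟ˢ_ = Maybe.≡-dec _≟ᵗ_
    ; init = init
    ; Cut = Cut
    ; Allowed = λ {p} → Allowed {p}
    ; holds-⊥ = λ { {inj₁ _} _ b → b
                  ; {inj₂ _} s (lift m) → contradiction m (ruleOf ⊥' s) }
    ; holds-∧ = λ { {inj₁ _} _ → id , id
                  ; {inj₂ _} {φ} {ψ} s → let (i , e) = ruleOf (φ ∧' ψ) s in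
                      (λ (x , y) → lift (i (lower x , lower y)))
                    , (λ m → lift (proj₁ (e (lower m))) , lift (proj₂ (e (lower m)))) }
    ; holds-∨ = λ { {inj₁ _} _ → id , id
                  ; {inj₂ _} {φ} {ψ} s → let (i , e) = ruleOf (φ ∨' ψ) s in
                      (λ m → lift (i (map-⊎ lower lower m)))
                    , (λ m → map-⊎ lift lift (e (lower m))) }
    ; holds-⇒ = λ {p} → holds-⇒ p
    ; holds-□ = λ {p} → holds-□ p
    ; holds-□◇ = λ {p} → holds-□◇ p
    ; cut-□ = λ { {inj₁ _} ((a , d) , _) → a , d , λ _ _ _ _ → ⊩⊤'
                ; {inj₂ _} (lift (_ , _ , n , _)) → lift n }
    ; cut-◇ = λ {p} → cut-◇ p
    ; holds-◇ = λ {p} → holds-◇ p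
    }
    where
    holds-⇒ : ∀ p {φ ψ} → Scope p (φ ⇒ ψ) →
      ((∀ q → p ⊑ q → Holds q φ → Holds q ψ) → Holds p (φ ⇒ ψ)) ×
      (Holds p (φ ⇒ ψ) → Holds p φ → Holds p ψ)
    holds-⇒ (inj₁ u) _ = (λ f v p → f (inj₁ v) (world p)) , λ t → t u ≤ʷ-refl
    holds-⇒ (inj₂ t) {φ} {ψ} s with ruleOf (φ ⇒ ψ) s
    ... | inj₁ m , e = (λ _ → lift m) , λ m' a → lift (e (lower m') (lower a))
    ... | inj₂ (S' , S'∈ , s' , a , b) , e =
            (λ f → contradiction
               (lower (f (inj₂ (tableau (root t) (types t) S')) (table s' λ _ → S'∈) (lift a))) b)
          , λ m' a → lift (e (lower m') (lower a))

    holds-□ : ∀ p {φ ψ} → Scope p (□ ψ) → Holds p (□ φ) →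
      (∀ s → Scope (init s) φ → Holds (init s) φ → Scope (init s) ψ → Holds (init s) ψ) → Holds p (□ ψ)
    -- Each member `v` of `a` gets a type containing `φ` and with `ψ` in scope. The hypothesis puts
    -- `ψ` into this type, all of which `v` forces.
    holds-□ (inj₁ u) {φ} {ψ} _ (a , d , f) g = a , d , λ w p v e →
      let (t , sφ , sψ , s , ht) = realise φ ψ (φ ∷ []) [φ]⊆ (⊩*-∷ (f w p v e) ⊩*-[])
      in ht (lower (g (just t) sφ (lift (s (here refl))) sψ))
    holds-□ (inj₂ t) {φ} {ψ} sc@(lift (good , m)) (lift n) g with ruleOf (□ ψ) sc
    ... | inj₁ k = lift k
    ... | inj₂ f =
            let (S' , S'∈ , a , b) = f n
            in contradiction
                 (lower (g (just (tableau (root t) (types t) S')) (sibling good S'∈ a) (lift a)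
                           (lift ((proj₁ good , S'∈) , sub-parts (root t) m (here refl))))) b

    holds-□◇ : ∀ p {φ ψ} → Scope p (◇ ψ) → Holds p (□ φ) → Holds p (◇ ψ) →
      Σ (Maybe Tableau) λ s → Scope (init s) φ × Holds (init s) φ × Scope (init s) ψ × Holds (init s) ψ
    holds-□◇ (inj₁ u) {φ} {ψ} _ (a , d , f) g =
      let (v , e , hψ) = g u ≤ʷ-refl a d
          (t , sφ , sψ , s , _) = realise φ ψ (φ ∷ ψ ∷ []) id (⊩*-∷ (f u ≤ʷ-refl v e) (⊩*-∷ hψ ⊩*-[]))
      in just t , sφ , lift (s (here refl)) , sψ , lift (s (there (here refl)))
    holds-□◇ (inj₂ t) {φ} {ψ} sc@(lift (good , _)) (lift n) (lift k) =
      let (S' , S'∈ , a , b) = proj₂ (ruleOf (◇ ψ) sc) k n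
      in just (tableau (root t) (types t) S') , sibling good S'∈ a , lift a , sibling good S'∈ b , lift b

    cut-◇ : ∀ p {φ} (κ : Cut p) → Scope p (◇ φ) → Holds p (◇ φ) →
      Σ (Maybe Tableau) λ s → Allowed {p} κ (init s) × Scope (init s) φ × Holds (init s) φ
    cut-◇ (inj₁ u) {φ} ((a , d) , χ) _ f =
      let (v , e , h) = f u ≤ʷ-refl a d
          (t , sφ , sχ , s , ht) = realise φ χ (φ ∷ []) [φ]⊆ (⊩*-∷ h ⊩*-[])
      in just t , (sχ , v , e , ht) , sφ , lift (s (here refl))
    cut-◇ (inj₂ t) (lift (χ , m , _ , f)) (lift (good , _)) (lift k) =
      let (S' , S'∈ , a , b) = f k
      in just (tableau (root t) (types t) S') , (lift ((proj₁ good , S'∈) , m) , b)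
           , sibling good S'∈ a , lift a

    holds-◇ : ∀ p {φ} → Scope p (◇ φ) →
      (∀ q → p ⊑ q → (κ : Cut q) → Σ Position λ r → Allowed {q} κ r × (Scope r φ → Holds r φ)) →
      Holds p (◇ φ)
    -- Cutting `a` to types with `φ` in scope makes the allowed position stand for a member of `a`.
    holds-◇ (inj₁ u) {φ} _ f v p a d with f (inj₁ v) (world p) ((a , d) , φ)
    ... | inj₂ t , (s , v' , e , ht) , g = v' , e , ht (lower (g s))
    holds-◇ (inj₂ t) {φ} sc@(lift (good , m)) f with proj₁ (ruleOf (◇ φ) sc)
    ... | inj₁ k = lift k
    -- The witnesses for the missing diamond form a cut at `S'` that allows only types without `φ`.
    ... | inj₂ (S' , S'∈ , s , n , g)
        with f (inj₂ (tableau (root t) (types t) S')) (table s λ _ → S'∈)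
               (lift (φ , sub-parts (root t) m (here refl) , n , g))
    ... | inj₂ _ , (s' , b) , h = contradiction (lower (h s')) b

theorem3p34 : (ℓ : Level) (Γ : FormSet) (φ : Form) →
    ((Γ ⊩inm[ ℓ ] φ) → (Γ ⊨[ ℓ ] φ)) × ((Γ ⊨[ ℓ ] φ) → (Γ ⊩inm[ ℓ ] φ))
theorem3p34 ℓ Γ φ =
    (λ f 𝔐 w x _ hΓ → pairModel-truth 𝔐 φ .proj₁
      (f (pairModel 𝔐) (w , x) λ ψ γ → pairModel-truth 𝔐 ψ .proj₂ (hΓ ψ γ)))
  , λ f M w hΓ →
      let open Positions M w
          open Structure blueprint
          -- The distinguished element, still at `w` in the empty history; there `Scope` is trivial
          -- and `Holds` is forcing in `M`.
          x = (nothing , 0)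
      in sound φ [] x tt (f structure [] x tt λ ψ γ → complete ψ [] x tt (hΓ ψ γ))
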